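{- Let $G$ be a non-discrete locally profinite group and let $K\subset G$ be a profinite open subgroup. Let $\mathcal{S}(G)$ be the Chabauty space of closed subgroups of $G$. Then the pair $(G,K)$ is fair if and only if $$\overline{\{gKg^{ -1}: g\in G\}}\subset\{\text{non-discrete closed subgroups of } G\},$$ where the closure is taken in $\mathcal{S}(G)$.
   Context: A locally profinite group is a topological group having an open subgroup which is profinite in the induced topology. Definition (fair): the pair $(G,K)$ is fair if for every open subgroup $H\subset K$ there is an open subgroup $H'\subset K$ such that for all $g\in G$ one has a strict inclusion $K\cap gH'g^{ -1}\subsetneq K\cap gHg^{ -1}$. $\mathcal{S}(G)$ is the set of all closed subgroups of $G$ equipped with the Chabauty topology, i.e. the topology generated by the sets $\{D\in\mathcal{S}(G): D\cap Q=\varnothing\}$ for $Q\subset G$ compact and $\{D\in\mathcal{S}(G): D\cap O\neq\varnothing\}$ for $O\subset G$ open; it is a compact Hausdorff space. -}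

module Defs where

open import Algebra.Bundles using (Group)
open import Data.List.Base using (List)
open import Data.List.Relation.Unary.Any using (Any)
open import Data.Product.Base using (Σ; Σ-syntax; ∃-syntax; _×_; _,_; proj₁; proj₂; uncurry)
open import Data.Product.Relation.Binary.Pointwise.NonDependent using (_×ₛ_)
open import Data.Unit.Base using (⊤; tt)
open import Function.Base using (_∘_)
open import Level using (Level; _⊔_; suc; Lift; lift)
open import Relation.Binary.Bundles using (Setoid)
open import Relation.Binary.Definitions using (_Respects_)
import Relation.Binary.Construct.On as On
open import Relation.Nullary using (¬_)
open import Relation.Unary
  using (Pred; _∈_; _⊆_; _⊂_; _≐_; _∩_; _∪_; ∁; ⋃; _≬_; Empty; Satisfiable; _⟨×⟩_)

-- Subsets are predicates, and a subset of a setoid is a predicate that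
-- respects its equality.  Open sets do so by fiat; elsewhere the condition is
-- left out where passing to the saturation of a predicate changes nothing.
--
-- Unions are taken over families indexed by types in the universe of the
-- carrier.  This loses nothing: a union of any class of open sets is also the
-- union of the family that picks, for each of its points, a member of the
-- class containing that point.

record Topology {c e} (X : Setoid c e) : Set (suc (suc c ⊔ e)) where
  open Setoid X using (Carrier; _≈_)
  field
    Open        : Pred (Pred Carrier c) (suc c ⊔ e)
    Open-resp-≈ : ∀ {U} → Open U → U Respects _≈_
    Open-resp-≐ : ∀ {U V} → U ≐ V → Open U → Open V
    Open-all    : Open (λ _ → Lift c ⊤)
    Open-∩      : ∀ {U V} → Open U → Open V → Open (U ∩ V)
    Open-⋃      : ∀ {I : Set c} {U : I → Pred Carrier c} →
                  (∀ i → Open (U i)) → Open (⋃ I U)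

open Topology public using (Open)

module _ {c e : Level} {X : Setoid c e} (T : Topology X) where
  open Setoid X using (Carrier; _≈_)

  Closed : Pred (Pred Carrier c) (suc c ⊔ e)
  Closed C = Open T (∁ C)

  Discrete : Set (suc c ⊔ e)
  Discrete = ∀ (U : Pred Carrier c) → U Respects _≈_ → Open T U

  Compact : Pred (Pred Carrier c) (suc c ⊔ e)
  Compact Q = ∀ {I : Set c} (U : I → Pred Carrier c) → (∀ i → Open T (U i)) →
              Q ⊆ ⋃ I U →
              ∃[ is ] (∀ {x} → x ∈ Q → Any (λ i → x ∈ U i) is)

  CompactSpace : Set (suc c ⊔ e)
  CompactSpace = Compact (λ _ → Lift c ⊤)

  Hausdorff : Set (suc c ⊔ e)
  Hausdorff = ∀ x y → ¬ (x ≈ y) →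
              ∃[ U ] ∃[ V ] (Open T U × Open T V × x ∈ U × y ∈ V × Empty (U ∩ V))

  Connected : Pred (Pred Carrier c) (suc c ⊔ e)
  Connected C = ∀ U V → Open T U → Open T V → C ⊆ U ∪ V →
                C ≬ U → C ≬ V → C ≬ (U ∩ V)

  TotallyDisconnected : Set (suc c ⊔ e)
  TotallyDisconnected = ∀ C → C Respects _≈_ → Connected C →
                        ∀ {x y} → x ∈ C → y ∈ C → x ≈ y

  closure : ∀ {a} → Pred Carrier a → Pred Carrier (a ⊔ suc c ⊔ e)
  closure A x = ∀ U → Open T U → x ∈ U → A ≬ U

Continuous : ∀ {c e f} {X : Setoid c e} {Y : Setoid c f} → Topology X → Topology Y →
             (Setoid.Carrier X → Setoid.Carrier Y) → Set (suc c ⊔ e ⊔ f)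
Continuous S T f = ∀ U → Open T U → Open S (U ∘ f)

infixr 2 _×ₜ_

_×ₜ_ : ∀ {c e} {X Y : Setoid c e} → Topology X → Topology Y → Topology (X ×ₛ Y)
_×ₜ_ {c} {e} {X} {Y} S T = record
  { Open        = λ W → W Respects Setoid._≈_ (X ×ₛ Y) × Rect W
  ; Open-resp-≈ = proj₁
  ; Open-resp-≐ = λ { (f , g) (r , o) →
      (λ p≈q v → f (r p≈q (g v))) ,
      (λ v → let (A , B , oA , oB , p , s) = o (g v) in A , B , oA , oB , p , f ∘ s) }
  ; Open-all    = (λ _ _ → lift tt) ,
      (λ _ → _ , _ , S.Open-all , T.Open-all , (lift tt , lift tt) , λ _ → lift tt)
  ; Open-∩      = λ { (r , o) (r′ , o′) →
      (λ { e (w , w′) → r e w , r′ e w′ }) ,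
      (λ { (w , w′) →
        let (A  , B  , oA  , oB  , (a  , b ) , s ) = o w
            (A′ , B′ , oA′ , oB′ , (a′ , b′) , s′) = o′ w′
        in A ∩ A′ , B ∩ B′ , S.Open-∩ oA oA′ , T.Open-∩ oB oB′ ,
           ((a , a′) , (b , b′)) ,
           λ { ((x , x′) , (y , y′)) → s (x , y) , s′ (x′ , y′) } }) }
  ; Open-⋃      = λ o →
      (λ { e (i , w) → i , proj₁ (o i) e w }) ,
      (λ { (i , w) → let (A , B , oA , oB , p , s) = proj₂ (o i) w
                     in A , B , oA , oB , p , λ q → i , s q })
  }
  where
  module S = Topology S
  module T = Topology T
  Rect : Pred (Pred (Setoid.Carrier (X ×ₛ Y)) c) (suc c ⊔ e)
  Rect W = ∀ {p} → p ∈ W →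
           ∃[ A ] ∃[ B ] (Open S A × Open T B × p ∈ (A ⟨×⟩ B) × (A ⟨×⟩ B) ⊆ W)

subspace : ∀ {c e} {X : Setoid c e} → Topology X → (P : Pred (Setoid.Carrier X) c) →
           Topology (On.setoid X (proj₁ {B = P}))
subspace {X = X} T P = record
  { Open        = λ U → ∃[ V ] (Open T V × U ≐ V ∘ proj₁)
  ; Open-resp-≈ = λ { (V , oV , f , g) x≈y u → g (T.Open-resp-≈ oV x≈y (f u)) }
  ; Open-resp-≐ = λ { (f , g) (V , oV , h , k) → V , oV , h ∘ g , f ∘ k }
  ; Open-all    = _ , T.Open-all , (λ _ → lift tt) , (λ _ → lift tt)
  ; Open-∩      = λ { (V , oV , f , g) (V′ , oV′ , f′ , g′) →
      V ∩ V′ , T.Open-∩ oV oV′ ,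
      (λ { (u , u′) → f u , f′ u′ }) , (λ { (v , v′) → g v , g′ v′ }) }
  ; Open-⋃      = λ o →
      _ , T.Open-⋃ (λ i → proj₁ (proj₂ (o i))) ,
      (λ { (i , u) → i , proj₁ (proj₂ (proj₂ (o i))) u }) ,
      (λ { (i , v) → i , proj₂ (proj₂ (proj₂ (o i))) v })
  }
  where module T = Topology T

module _ {c e s : Level} (X : Setoid c e) where
  open Setoid X using (Carrier; _≈_)

  data Generated (𝓑 : Pred (Pred Carrier c) s) : Pred (Pred Carrier c) (suc c ⊔ e ⊔ s) where
    basic  : ∀ {U} → U ∈ 𝓑 → Generated 𝓑 U
    resp-≐ : ∀ {U V} → U ≐ V → Generated 𝓑 U → Generated 𝓑 V
    all    : Generated 𝓑 (λ _ → Lift c ⊤)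
    inter  : ∀ {U V} → Generated 𝓑 U → Generated 𝓑 V → Generated 𝓑 (U ∩ V)
    union  : ∀ {I : Set c} {U : I → Pred Carrier c} →
             (∀ i → Generated 𝓑 (U i)) → Generated 𝓑 (⋃ I U)

  Generated-resp-≈ : ∀ {𝓑} → (∀ {U} → U ∈ 𝓑 → U Respects _≈_) →
                     ∀ {U} → Generated 𝓑 U → U Respects _≈_
  Generated-resp-≈ r (basic b)          x≈y u       = r b x≈y u
  Generated-resp-≈ r (resp-≐ (f , g) o) x≈y v       = f (Generated-resp-≈ r o x≈y (g v))
  Generated-resp-≈ r all                _   _       = lift tt
  Generated-resp-≈ r (inter o o′)       x≈y (u , v) =
    Generated-resp-≈ r o x≈y u , Generated-resp-≈ r o′ x≈y v
  Generated-resp-≈ r (union o)          x≈y (i , u) = i , Generated-resp-≈ r (o i) x≈y u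

generatedBy : ∀ {c e} (X : Setoid c e) (𝓑 : Pred (Pred (Setoid.Carrier X) c) c) →
              (∀ {U} → U ∈ 𝓑 → U Respects Setoid._≈_ X) → Topology X
generatedBy X 𝓑 r = record
  { Open        = Generated X 𝓑
  ; Open-resp-≈ = Generated-resp-≈ X r
  ; Open-resp-≐ = resp-≐
  ; Open-all    = all
  ; Open-∩      = inter
  ; Open-⋃      = union
  }

record TopologicalGroup ℓ : Set (suc (suc ℓ)) where
  field
    group : Group ℓ ℓ
  open Group group public
  field
    topology : Topology setoid
    ∙-cont   : Continuous (topology ×ₜ topology) topology (uncurry _∙_)
    ⁻¹-cont  : Continuous topology topology _⁻¹

record Subgroup {ℓ} (G : Group ℓ ℓ) : Set (suc ℓ) where
  open Group G
  field
    ⟦_⟧       : Pred Carrier ℓ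
    resp      : ⟦_⟧ Respects _≈_
    ε-closed  : ε ∈ ⟦_⟧
    ∙-closed  : ∀ {x y} → x ∈ ⟦_⟧ → y ∈ ⟦_⟧ → x ∙ y ∈ ⟦_⟧
    ⁻¹-closed : ∀ {x} → x ∈ ⟦_⟧ → x ⁻¹ ∈ ⟦_⟧

open Subgroup public using (⟦_⟧)

subgroup : ∀ {ℓ} {G : Group ℓ ℓ} → Subgroup G → Group ℓ ℓ
subgroup {G = G} H = record
  { Carrier = Σ Carrier ⟦ H ⟧
  ; _≈_     = λ x y → proj₁ x ≈ proj₁ y
  ; _∙_     = λ { (x , p) (y , q) → x ∙ y , H.∙-closed p q }
  ; ε       = ε , H.ε-closed
  ; _⁻¹     = λ { (x , p) → x ⁻¹ , H.⁻¹-closed p }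
  ; isGroup = record
    { isMonoid = record
      { isSemigroup = record
        { isMagma = record
          { isEquivalence = On.isEquivalence proj₁ isEquivalence
          ; ∙-cong        = ∙-cong
          }
        ; assoc = λ x y z → assoc (proj₁ x) (proj₁ y) (proj₁ z)
        }
      ; identity = (λ x → identityˡ (proj₁ x)) , (λ x → identityʳ (proj₁ x))
      }
    ; inverse = (λ x → inverseˡ (proj₁ x)) , (λ x → inverseʳ (proj₁ x))
    ; ⁻¹-cong = ⁻¹-cong
    }
  }
  where
  open Group G
  module H = Subgroup H

module _ {ℓ : Level} (G : TopologicalGroup ℓ) where
  open TopologicalGroup G

  topologicalSubgroup : Subgroup group → TopologicalGroup ℓ
  topologicalSubgroup H = record
    { group    = subgroup H
    ; topology = subspace topology ⟦ H ⟧
    ; ∙-cont   = λ { U (V , oV , f , g) →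
        let (r , o) = ∙-cont V oV in
        (λ p≈q u → g (r p≈q (f u))) ,
        (λ u → let (A , B , oA , oB , (a , b) , s) = o (f u) in
          A ∘ proj₁ , B ∘ proj₁ ,
          (A , oA , (λ z → z) , (λ z → z)) , (B , oB , (λ z → z) , (λ z → z)) ,
          (a , b) , λ { (x , y) → g (s (x , y)) }) }
    ; ⁻¹-cont  = λ { U (V , oV , f , g) → V ∘ _⁻¹ , ⁻¹-cont V oV , f , g }
    }

  Profinite : Set (suc ℓ)
  Profinite = CompactSpace topology × Hausdorff topology × TotallyDisconnected topology

module _ {ℓ : Level} (G : TopologicalGroup ℓ) where
  open TopologicalGroup G

  LocallyProfinite : Set (suc ℓ)
  LocallyProfinite = Σ[ H ∈ Subgroup group ]
    (Open topology ⟦ H ⟧ × Profinite (topologicalSubgroup G H))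

  conjugate : Carrier → Pred Carrier ℓ → Pred Carrier ℓ
  conjugate g S x = ∃[ s ] (s ∈ S × x ≈ g ∙ s ∙ g ⁻¹)

  Fair : Subgroup group → Set (suc ℓ)
  Fair K =
    ∀ (H : Subgroup group) → Open topology ⟦ H ⟧ → ⟦ H ⟧ ⊆ ⟦ K ⟧ →
    Σ[ H′ ∈ Subgroup group ] (Open topology ⟦ H′ ⟧ × ⟦ H′ ⟧ ⊆ ⟦ K ⟧ ×
      (∀ g → (⟦ K ⟧ ∩ conjugate g ⟦ H′ ⟧) ⊂ (⟦ K ⟧ ∩ conjugate g ⟦ H ⟧)))

  ClosedSubgroup : Set (suc ℓ)
  ClosedSubgroup = Σ[ D ∈ Subgroup group ] Closed topology ⟦ D ⟧

  ∣_∣ : ClosedSubgroup → Pred Carrier ℓ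
  ∣ D , _ ∣ = ⟦ D ⟧

  closedSubgroups : Setoid (suc ℓ) ℓ
  closedSubgroups = record
    { Carrier       = ClosedSubgroup
    ; _≈_           = λ D E → ∣ D ∣ ≐ ∣ E ∣
    ; isEquivalence = record
      { refl  = (λ x → x) , (λ x → x)
      ; sym   = λ { (f , g) → g , f }
      ; trans = λ { (f , g) (h , k) → h ∘ f , g ∘ k }
      }
    }

  data ChabautySubbasis : Pred (Pred ClosedSubgroup (suc ℓ)) (suc ℓ) where
    miss : ∀ {Q} → Q Respects _≈_ → Compact topology Q →
           ChabautySubbasis (λ D → Lift (suc ℓ) (Empty (∣ D ∣ ∩ Q)))
    hit  : ∀ {O} → Open topology O →
           ChabautySubbasis (λ D → Lift (suc ℓ) (Satisfiable (∣ D ∣ ∩ O)))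

  chabauty : Topology closedSubgroups
  chabauty = generatedBy closedSubgroups ChabautySubbasis λ where
    (miss _ _) (f , g) (lift n)           → lift (λ { x (d , q) → n x (g d , q) })
    (hit _)    (f , g) (lift (x , d , o)) → lift (x , f d , o)

  -- The conjugates of a subgroup as points of the space of closed subgroups;
  -- for an open subgroup every g occurs, since its conjugates are closed.
  conjugatesOf : Subgroup group → Pred ClosedSubgroup ℓ
  conjugatesOf K D = ∃[ g ] (∣ D ∣ ≐ conjugate g ⟦ K ⟧)

  nonDiscreteSubgroups : Pred ClosedSubgroup (suc ℓ)
  nonDiscreteSubgroups (D , _) =
    ¬ Discrete (TopologicalGroup.topology (topologicalSubgroup G D))

{-# OPTIONS --safe #-}

-- For open subgroups H′ ⊆ H of K, the inclusion K ∩ gH′g⁻¹ ⊆ K ∩ gHg⁻¹ is strict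
-- iff g⁻¹Kg hits the set H ∖ H′, which is compact and open.  If D in the closure
-- of the conjugates of K were discrete, it would meet some open subgroup H ⊆ K
-- trivially (van Dantzig), so D, and hence some conjugate of K, would miss
-- H ∖ H′, contradicting fairness.  Conversely, if fairness fails at H, then every
-- open subgroup L contains H ∩ gKg⁻¹ for some g.  The sets of such g form a
-- filter base as L varies; a limit D of the conjugates gKg⁻¹ along an ultrafilter
-- refining it has H ∩ D in every L, so H ∩ D = 1 and D is discrete.

module Submission where

open import Axiom.DoubleNegationElimination using (em⇒dne)
open import Axiom.ExcludedMiddle using (ExcludedMiddle)
open import Axiom.Extensionality.Propositional using (Extensionality)
open import Data.Bool.Base using (Bool; T)
open import Data.Empty using (⊥; ⊥-elim)
open import Data.List.Base using ([]; _∷_; catMaybes)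
open import Data.List.Relation.Unary.Any as Any using (Any; here; there)
open import Data.Maybe.Base using (Maybe; just; nothing; maybe)
open import Data.Product.Base using (∃; Σ-syntax; ∃-syntax; _×_; _,_; proj₁; proj₂)
open import Data.Sum.Base as Sum using (_⊎_; inj₁; inj₂; fromInj₁; fromInj₂; [_,_])
open import Data.Unit.Polymorphic.Base using (⊤; tt)
open import Function.Base using (_∘_; id; case_of_)
open import Function.Bundles using (_⇔_; mk⇔)
open import Level using (Level; _⊔_; Lift; lift; lower) renaming (suc to lsuc)
open import Relation.Binary.Bundles using (Setoid)
open import Relation.Binary.PropositionalEquality.Core as ≡ using (_≡_; subst)
open import Relation.Binary.Definitions using (_Respects_)
open import Relation.Nullary using (¬_; Dec; yes; no)
open import Relation.Nullary.Decidable using (True; toWitness; fromWitness)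
open import Relation.Nullary.Decidable.Core using (isYes)
open import Relation.Unary
  using (Pred; _∈_; _∉_; _⊆_; _≐_; _∩_; _∪_; ∁; ⋃; _≬_; _⊂_; Satisfiable)
open import Defs

-- Excluded middle for arbitrary types decides inhabitation, hence also serves
-- as a choice operator, and it makes every proposition small.

module Classical (em : ∀ {a} → ExcludedMiddle a) (ext : ∀ {a b} → Extensionality a b) where

  dne : ∀ {a} {P : Set a} → ¬ ¬ P → P
  dne = em⇒dne em

  Resize : ∀ {a} b → Set a → Set b
  Resize b P = Lift b (True (em {P = P}))

  resize : ∀ {a b} {P : Set a} → P → Resize b P
  resize p = lift (fromWitness p)

  unresize : ∀ {a b} {P : Set a} → Resize b P → P
  unresize (lift t) = toWitness t

  -- Ordinals and Zorn's lemma.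

  -- Ordinals are well-founded trees; distinct trees may be ≤ each other.

  data Ord a : Set (lsuc a) where
    sup : {I : Set a} → (I → Ord a) → Ord a

  _≤_ : ∀ {a} → Ord a → Ord a → Set a
  sup f ≤ sup g = ∀ i → ∃[ j ] f i ≤ g j

  _<_ : ∀ {a} → Ord a → Ord a → Set a
  α < sup g = ∃[ j ] α ≤ g j

  sup≤ : ∀ {a} {I : Set a} {f : I → Ord a} β → (∀ i → f i < β) → sup f ≤ β
  sup≤ (sup g) p = p

  -- If some `f i` lies strictly above every `g j`, then `sup g ≤ f i`, whence `β < α`. Otherwise
  -- each `i` has a `j` with `g j < f i` false, and induction gives `f i ≤ g j`.
  ≤⊎> : ∀ {a} (α β : Ord a) → α ≤ β ⊎ β < α
  ≤⊎> (sup f) (sup g) with em {P = ∃[ i ] (∀ j → g j < f i)}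
  ... | yes (i , p) = inj₂ (i , sup≤ (f i) p)
  ... | no ¬p = inj₁ λ i → dne λ ¬q → ¬p (i , λ j →
          fromInj₂ (λ p → ⊥-elim (¬q (j , p))) (≤⊎> (f i) (g j)))

  -- Zorn's lemma for a property Φ of subsets of Y: enlarge F₀ transfinitely as
  -- long as possible.  The process stops by replacement: each y ∈ Y that is
  -- ever added is added at some stage, and these stages have a supremum.

  module Zorn {a b} {Y : Set a} (Φ : Pred (Pred Y a) b)
    (Φ-resp : ∀ {E F} → E ≐ F → Φ E → Φ F)
    (Φ-chain : ∀ {I : Set a} (F : I → Pred Y a) → I → (∀ i → Φ (F i)) →
               (∀ i j → F i ⊆ F j ⊎ F j ⊆ F i) → Φ (⋃ I F))
    (F₀ : Pred Y a) (Φ-F₀ : Φ F₀) where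

    -- Truth values forget proofs, so extensionality gives equivalent subsets equal codes.
    code : Pred Y a → Y → Bool
    code F y = isYes (em {P = F y})

    decode : (Y → Bool) → Pred Y a
    decode c y = Lift a (T (c y))

    code-decode : ∀ F → F ≐ decode (code F)
    code-decode F = (λ y∈F → lift (fromWitness y∈F)) , (λ t → toWitness (lower t))

    code-cong : ∀ {E F} → E ≐ F → code E ≡ code F
    code-cong {E} {F} (E⊆F , F⊆E) = ext λ y → isYes-cong y (em {P = E y}) (em {P = F y})
      where
      isYes-cong : ∀ y (p : Dec (E y)) (q : Dec (F y)) → isYes p ≡ isYes q
      isYes-cong y (yes _) (yes _) = ≡.refl
      isYes-cong y (no _)  (no _)  = ≡.refl
      isYes-cong y (yes p) (no ¬q) = ⊥-elim (¬q (E⊆F p))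
      isYes-cong y (no ¬p) (yes q) = ⊥-elim (¬p (F⊆E q))

    Enlargement : Pred Y a → Set (lsuc a ⊔ b)
    Enlargement F = Σ[ E ∈ Pred Y a ] (Φ E × F ⊆ E × ¬ (E ⊆ F))

    pick : ∀ {F} → Dec (Enlargement F) → Pred Y a
    pick (yes (E , _)) = E
    pick {F} (no _)    = F

    -- Choosing the enlargement from the code of F alone makes it depend on F
    -- only up to ≐.
    enlarge : Pred Y a → Pred Y a
    enlarge F = pick (em {P = Enlargement (decode (code F))})

    enlarge-cong : ∀ {E F} → E ≐ F → enlarge E ⊆ enlarge F
    enlarge-cong E≐F {y} =
      subst (λ c → pick (em {P = Enlargement (decode c)}) y) (code-cong E≐F)

    ⊆enlarge : ∀ F → F ⊆ enlarge F
    ⊆enlarge F y∈F with em {P = Enlargement (decode (code F))}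
    ... | yes (_ , _ , F⊆E , _) = F⊆E (proj₁ (code-decode F) y∈F)
    ... | no _ = proj₁ (code-decode F) y∈F

    Φ-enlarge : ∀ F → Φ F → Φ (enlarge F)
    Φ-enlarge F ΦF with em {P = Enlargement (decode (code F))}
    ... | yes (_ , ΦE , _) = ΦE
    ... | no _ = Φ-resp (code-decode F) ΦF

    enlarge-fixed⇒maximal : ∀ F → enlarge F ⊆ F → ∀ E → Φ E → F ⊆ E → E ⊆ F
    enlarge-fixed⇒maximal F fixed E ΦE F⊆E {y} y∈E with em {P = Enlargement (decode (code F))}
    ... | yes (_ , _ , _ , ¬⊆) = ⊥-elim (¬⊆ (proj₁ (code-decode F) ∘ fixed))
    ... | no ¬enl = dne λ y∉F → ¬enl
            (E , ΦE , F⊆E ∘ proj₂ (code-decode F) ,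
             λ E⊆F → y∉F (proj₂ (code-decode F) (E⊆F y∈E)))

    -- The index `nothing` puts `F₀` into every stage and keeps the index type inhabited, as
    -- `Φ-chain` demands.
    stage : Ord a → Pred Y a
    stage (sup f) = ⋃ (Maybe _) (maybe (λ i → enlarge (stage (f i))) F₀)

    mutual
      stage-mono : ∀ α β → α ≤ β → stage α ⊆ stage β
      stage-mono (sup f) (sup g) p (nothing , y∈) = nothing , y∈
      stage-mono (sup f) (sup g) p (just i , y∈) =
        let (j , q) = p i in just j , enlarge-mono (f i) (g j) q y∈

      -- An arbitrary choice of enlargements need not be monotone, but along stages it is. If also
      -- `β ≤ α`, the two stages agree up to `≐`; otherwise `α < β`, and the enlargement of
      -- `stage α` already lies in `stage β`.
      enlarge-mono : ∀ α β → α ≤ β → enlarge (stage α) ⊆ enlarge (stage β)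
      enlarge-mono α β p with ≤⊎> β α
      ... | inj₁ q = enlarge-cong (stage-mono α β p , stage-mono β α q)
      ... | inj₂ α<β = ⊆enlarge (stage β) ∘ enlarge-stage⊆ α β α<β

      enlarge-stage⊆ : ∀ α β → α < β → enlarge (stage α) ⊆ stage β
      enlarge-stage⊆ α (sup g) (j , p) y∈ = just j , enlarge-mono α (g j) p y∈

    Φ-stage : ∀ α → Φ (stage α)
    Φ-stage (sup f) = Φ-chain (maybe (λ i → enlarge (stage (f i))) F₀) nothing
      (λ { nothing → Φ-F₀ ; (just i) → Φ-enlarge _ (Φ-stage (f i)) })
      λ { nothing  nothing  → inj₁ id
        ; nothing  (just j) → inj₁ (F₀⊆ (f j))
        ; (just i) nothing  → inj₂ (F₀⊆ (f i))
        ; (just i) (just j) → comparable (f i) (f j)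
        }
      where
      F₀⊆ : ∀ α → F₀ ⊆ enlarge (stage α)
      F₀⊆ (sup g) y∈ = ⊆enlarge (stage (sup g)) (nothing , y∈)
      comparable : ∀ α β → enlarge (stage α) ⊆ enlarge (stage β) ⊎
                           enlarge (stage β) ⊆ enlarge (stage α)
      comparable α β with ≤⊎> α β
      ... | inj₁ α≤β = inj₁ (enlarge-mono α β α≤β)
      ... | inj₂ β<α = inj₂ (⊆enlarge _ ∘ enlarge-stage⊆ β α β<α)

    entry : Y → Ord a
    entry y with em {P = ∃[ α ] y ∈ enlarge (stage α)}
    ... | yes (α , _) = α
    -- A default for points that never enter; any ordinal would do.
    ... | no _        = sup {I = Lift _ ⊥} λ ()

    ∈enlarge-entry : ∀ {y} α → y ∈ enlarge (stage α) → y ∈ enlarge (stage (entry y))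
    ∈enlarge-entry {y} α y∈ with em {P = ∃[ α ] y ∈ enlarge (stage α)}
    ... | yes (_ , y∈′) = y∈′
    ... | no never      = ⊥-elim (never (α , y∈))

    maximal : Σ[ F ∈ Pred Y a ] (Φ F × F₀ ⊆ F × (∀ E → Φ E → F ⊆ E → E ⊆ F))
    maximal = stage (sup entry) , Φ-stage (sup entry) , (λ y∈ → nothing , y∈) ,
      enlarge-fixed⇒maximal _ λ {y} y∈ → just y , ∈enlarge-entry (sup entry) y∈

  -- Filters and ultrafilters.

  record IsFilter {x f} {X : Set x} (F : Pred (Pred X x) f) : Set (lsuc x ⊔ f) where
    field
      upward    : ∀ {A B} → A ⊆ B → A ∈ F → B ∈ F
      ∩-closed  : ∀ {A B} → A ∈ F → B ∈ F → A ∩ B ∈ F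
      whole     : (λ _ → ⊤) ∈ F
      nonempty  : ∀ {A} → A ∈ F → Satisfiable A

  IsUltrafilter : ∀ {x f} {X : Set x} → Pred (Pred X x) f → Set (lsuc x ⊔ f)
  IsUltrafilter F = IsFilter F × (∀ A → A ∉ F → ∁ A ∈ F)

  -- Zorn's lemma gives a maximal filter `F`. If `∁ A` is not in `F`, every member of `F` meets `A`,
  -- so `F` and `A` together generate a filter, `adjoin A`; by maximality `A` was in `F` already.
  ultrafilter : ∀ {x} {X : Set x} (F₀ : Pred (Pred X x) (lsuc x)) → IsFilter F₀ →
                Σ[ F ∈ Pred (Pred X x) (lsuc x) ] (IsUltrafilter F × F₀ ⊆ F)
  ultrafilter {x} {X} F₀ filter₀ = F , (F-filter , ultra) , F₀⊆F
    where
    open IsFilter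
    resp : ∀ {E F : Pred (Pred X x) (lsuc x)} → E ≐ F → IsFilter E → IsFilter F
    resp (E⊆F , F⊆E) E-filter = record
      { upward   = λ A⊆B → E⊆F ∘ upward E-filter A⊆B ∘ F⊆E
      ; ∩-closed = λ a b → E⊆F (∩-closed E-filter (F⊆E a) (F⊆E b))
      ; whole    = E⊆F (whole E-filter)
      ; nonempty = nonempty E-filter ∘ F⊆E
      }
    chain : ∀ {I : Set (lsuc x)} (F : I → Pred (Pred X x) (lsuc x)) → I →
            (∀ i → IsFilter (F i)) → (∀ i j → F i ⊆ F j ⊎ F j ⊆ F i) → IsFilter (⋃ I F)
    chain F i₀ filters comparable = record
      { upward   = λ { A⊆B (i , a) → i , upward (filters i) A⊆B a }
      ; ∩-closed = λ { (i , a) (j , b) → case comparable i j of λ where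
          (inj₁ i⊆j) → j , ∩-closed (filters j) (i⊆j a) b
          (inj₂ j⊆i) → i , ∩-closed (filters i) a (j⊆i b) }
      ; whole    = i₀ , whole (filters i₀)
      ; nonempty = λ { (i , a) → nonempty (filters i) a }
      }
    module Z = Zorn IsFilter resp chain F₀ filter₀
    F = proj₁ Z.maximal
    F-filter = proj₁ (proj₂ Z.maximal)
    F₀⊆F : F₀ ⊆ F
    F₀⊆F = proj₁ (proj₂ (proj₂ Z.maximal))
    adjoin : Pred X x → Pred (Pred X x) (lsuc x)
    adjoin A B = Σ[ C ∈ Pred X x ] (C ∈ F × A ∩ C ⊆ B)
    adjoin-filter : ∀ A → ∁ A ∉ F → IsFilter (adjoin A)
    adjoin-filter A ∁A∉F = record
      { upward   = λ { B⊆B′ (C , c , s) → C , c , B⊆B′ ∘ s }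
      ; ∩-closed = λ { (C , c , s) (C′ , c′ , s′) → C ∩ C′ , ∩-closed F-filter c c′ ,
                       λ { (p , q , q′) → s (p , q) , s′ (p , q′) } }
      ; whole    = _ , whole F-filter , λ _ → tt
      ; nonempty = λ { (C , c , s) → dne λ empty → ∁A∉F
                       (upward F-filter (λ q p → empty (_ , s (p , q))) c) }
      }
    ultra : ∀ A → A ∉ F → ∁ A ∈ F
    ultra A A∉F = dne λ ∁A∉F → A∉F (proj₂ (proj₂ (proj₂ Z.maximal)) (adjoin A)
      (adjoin-filter A ∁A∉F) (λ {C} c → C , c , proj₂) (_ , whole F-filter , proj₁))

  -- Open sets and compactness.

  module _ {c e} {X : Setoid c e} (T : Topology X) where
    open Setoid X using (Carrier)
    private module T = Topology T

    -- Choosing one neighbourhood per point of `U` keeps the index type of the union in universe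
    -- `c`.
    open-local : ∀ {U} → (∀ {x} → x ∈ U → ∃[ O ] (Open T O × x ∈ O × O ⊆ U)) → Open T U
    open-local {U} near = T.Open-resp-≐
      ((λ { ((_ , u) , o) → proj₂ (proj₂ (proj₂ (near u))) o }) ,
       (λ {x} u → (x , u) , proj₁ (proj₂ (proj₂ (near u)))))
      (T.Open-⋃ {I = ∃ U} (λ (_ , u) → proj₁ (proj₂ (near u))))

    open-∪ : ∀ {U V} → Open T U → Open T V → Open T (U ∪ V)
    open-∪ oU oV = open-local λ where
      (inj₁ u) → _ , oU , u , inj₁
      (inj₂ v) → _ , oV , v , inj₂

    -- Compactness for directed families of sets, of any size, whose interiors
    -- cover C.
    compact-directed : ∀ {C j r} → Compact T C → {J : Set j} (R : J → Pred Carrier r) → J →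
      (∀ i j → ∃[ k ] (R i ⊆ R k × R j ⊆ R k)) →
      (∀ {x} → x ∈ C → ∃[ j ] ∃[ O ] (Open T O × x ∈ O × O ⊆ R j)) →
      ∃[ j ] C ⊆ R j
    compact-directed {C} compact {J} R j₀ directed local =
      proj₁ (bound (proj₁ cover)) ,
      λ x∈C → proj₂ (bound (proj₁ cover))
        (Any.map (λ {(_ , y∈C)} → proj₂ (proj₂ (proj₂ (proj₂ (local y∈C))))) (proj₂ cover x∈C))
      where
      index : ∃ C → J
      index (_ , x∈C) = proj₁ (local x∈C)
      -- The cover is indexed by points of `C`, because `J` may be too large for `Compact`.
      cover : ∃[ is ] (∀ {x} → x ∈ C → Any (λ i → x ∈ proj₁ (proj₂ (local (proj₂ i)))) is)
      cover = compact {I = ∃ C} (λ (_ , x∈C) → proj₁ (proj₂ (local x∈C)))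
        (λ (_ , x∈C) → proj₁ (proj₂ (proj₂ (local x∈C))))
        (λ x∈C → (_ , x∈C) , proj₁ (proj₂ (proj₂ (proj₂ (local x∈C)))))
      bound : ∀ is → ∃[ j ] (∀ {x} → Any (λ i → x ∈ R (index i)) is → x ∈ R j)
      bound [] = j₀ , λ ()
      bound (i ∷ is) =
        let (j , below)   = bound is
            (k , i≤ , j≤) = directed (index i) j
        in k , λ { (here x∈) → i≤ x∈ ; (there x∈) → j≤ (below x∈) }

    -- With `∁ C` added as index `nothing`, the family covers `Q`. No point of `C` needs that
    -- member, so `catMaybes` may drop it from the finite subcover.
    closed⊆compact⇒compact : ∀ {C Q} → Compact T Q → Closed T C → C ⊆ Q → Compact T C
    closed⊆compact⇒compact {C} compact closed C⊆Q {I} U oU C⊆⋃U =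
      let (ms , cover) = compact V (λ { nothing → closed ; (just i) → oU i }) Q⊆⋃V
      in catMaybes ms , λ x∈C → prune ms x∈C (cover (C⊆Q x∈C))
      where
      V : Maybe I → Pred Carrier c
      V = maybe U (∁ C)
      Q⊆⋃V : ∀ {x} → _ → x ∈ ⋃ (Maybe I) V
      Q⊆⋃V {x} _ with em {P = x ∈ C}
      ... | yes x∈C = let (i , u) = C⊆⋃U x∈C in just i , u
      ... | no x∉C  = nothing , x∉C
      prune : ∀ ms {x} → x ∈ C → Any (λ m → x ∈ V m) ms → Any (λ i → x ∈ U i) (catMaybes ms)
      prune (nothing ∷ ms) x∈C (here x∉C) = ⊥-elim (x∉C x∈C)
      prune (nothing ∷ ms) x∈C (there a)  = prune ms x∈C a
      prune (just i ∷ ms)  x∈C (here u)   = here u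
      prune (just i ∷ ms)  x∈C (there a)  = there (prune ms x∈C a)

    compactSubspace⇒compact : ∀ {Q} → CompactSpace (subspace T Q) → Compact T Q
    compactSubspace⇒compact compact U oU Q⊆⋃U =
      let (is , cover) = compact (λ i → U i ∘ proj₁)
                           (λ i → U i , oU i , id , id) (λ {x} _ → Q⊆⋃U (proj₂ x))
      in is , λ q → cover {_ , q} _

  -- Neighbourhoods of the identity and open subgroups.

  module GroupTopology {ℓ} (G : TopologicalGroup ℓ) where
    open TopologicalGroup G
    open import Algebra.Properties.Group group
    open import Relation.Binary.Reasoning.Setoid setoid
    open Topology topology using (Open-resp-≈; Open-resp-≐; Open-∩)

    open-∙ˡ : ∀ a {U} → Open topology U → Open topology (λ x → a ∙ x ∈ U)
    open-∙ˡ a oU = open-local topology λ u →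
      let (_ , B , _ , oB , (a∈A , x∈B) , AB⊆U) = proj₂ (∙-cont _ oU) u
      in B , oB , x∈B , λ b → AB⊆U (a∈A , b)

    open-∙ʳ : ∀ a {U} → Open topology U → Open topology (λ x → x ∙ a ∈ U)
    open-∙ʳ a oU = open-local topology λ u →
      let (A , _ , oA , _ , (x∈A , a∈B) , AB⊆U) = proj₂ (∙-cont _ oU) u
      in A , oA , x∈A , λ b → AB⊆U (b , a∈B)

    OpenNbhd-ε : Set (lsuc ℓ)
    OpenNbhd-ε = ∃[ V ] (Open topology V × ε ∈ V)

    root : ((V , _) : OpenNbhd-ε) →
           Σ[ (W , _) ∈ OpenNbhd-ε ] (∀ {x y} → x ∈ W → y ∈ W → x ∙ y ∈ V)
    root (V , oV , ε∈V) =
      let (A , B , oA , oB , (ε∈A , ε∈B) , AB⊆V) =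
            proj₂ (∙-cont _ oV) {ε , ε} (Open-resp-≈ oV (sym (identityˡ ε)) ε∈V)
      in (A ∩ B , Open-∩ oA oB , ε∈A , ε∈B) , λ (x∈A , _) (_ , y∈B) → AB⊆V (x∈A , y∈B)

    abstract
      symmetricCubeRoot : ((V , _) : OpenNbhd-ε) → Σ[ (W , _) ∈ OpenNbhd-ε ]
        ((∀ {x} → x ∈ W → x ⁻¹ ∈ W) × (∀ {x y z} → x ∈ W → y ∈ W → z ∈ W → x ∙ y ∙ z ∈ V))
      symmetricCubeRoot V =
        let (W , WW⊆V)                = root V
            ((W′ , oW′ , ε∈W′) , W′W′⊆W) = root W
            oW = proj₁ (proj₂ W)
        in ((λ x → x ∈ W′ × x ⁻¹ ∈ W′) , Open-∩ oW′ (⁻¹-cont _ oW′) ,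
              ε∈W′ , Open-resp-≈ oW′ (sym ε⁻¹≈ε) ε∈W′) ,
           (λ (x∈ , x⁻¹∈) → x⁻¹∈ , Open-resp-≈ oW′ (sym (⁻¹-involutive _)) x∈) ,
           λ (x∈ , _) (y∈ , _) (z∈ , _) →
             -- The third factor is read as z ε, so that it too is a product of two elements of
             -- `W′`.
             WW⊆V (W′W′⊆W x∈ y∈) (Open-resp-≈ oW (identityʳ _) (W′W′⊆W z∈ ε∈W′))

    nbhd⇒open : (L : Subgroup group) ((V , _) : OpenNbhd-ε) → V ⊆ ⟦ L ⟧ → Open topology ⟦ L ⟧
    nbhd⇒open L (V , oV , ε∈V) V⊆L = open-local topology λ {x} x∈L →
      _ , open-∙ˡ (x ⁻¹) oV , Open-resp-≈ oV (sym (inverseˡ x)) ε∈V ,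
      λ {y} v → L.resp (\\-leftDividesˡ x y) (L.∙-closed x∈L (V⊆L v))
      where module L = Subgroup L

    -- If x lies outside `L`, then so does the whole open coset xL.
    open⇒closed : (L : Subgroup group) → Open topology ⟦ L ⟧ → Closed topology ⟦ L ⟧
    open⇒closed L oL = open-local topology λ {x} x∉L →
      _ , open-∙ˡ (x ⁻¹) oL , L.resp (sym (inverseˡ x)) L.ε-closed ,
      λ {y} u y∈L → x∉L (L.resp (begin
        y ∙ (x ⁻¹ ∙ y) ⁻¹  ≈⟨ ∙-congˡ (⁻¹-anti-homo-\\ x y) ⟩
        y ∙ (y ⁻¹ ∙ x)     ≈⟨ \\-leftDividesˡ y x ⟩
        x                  ∎) (L.∙-closed y∈L (L.⁻¹-closed u)))
      where module L = Subgroup L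

    _⊓_ : Subgroup group → Subgroup group → Subgroup group
    H ⊓ L = record
      { ⟦_⟧       = ⟦ H ⟧ ∩ ⟦ L ⟧
      ; resp      = λ { x≈y (h , l) → H.resp x≈y h , L.resp x≈y l }
      ; ε-closed  = H.ε-closed , L.ε-closed
      ; ∙-closed  = λ { (h , l) (h′ , l′) → H.∙-closed h h′ , L.∙-closed l l′ }
      ; ⁻¹-closed = λ { (h , l) → H.⁻¹-closed h , L.⁻¹-closed l }
      }
      where
      module H = Subgroup H
      module L = Subgroup L

    -- The intersection of all open subgroups, and van Dantzig's theorem.

    OpenSubgroup : Set (lsuc ℓ)
    OpenSubgroup = Σ[ L ∈ Subgroup group ] Open topology ⟦ L ⟧

    -- Van Dantzig's theorem is reached by showing this intersection connected, hence trivial. The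
    -- quantifier over open subgroups leaves universe `ℓ`, whence `Resize`.
    core : Subgroup group
    core = record
      { ⟦_⟧       = λ x → Resize ℓ ((L : OpenSubgroup) → x ∈ ⟦ proj₁ L ⟧)
      ; resp      = λ x≈y x∈ → resize λ L → Subgroup.resp (proj₁ L) x≈y (unresize x∈ L)
      ; ε-closed  = resize λ L → Subgroup.ε-closed (proj₁ L)
      ; ∙-closed  = λ x∈ y∈ → resize λ L →
          Subgroup.∙-closed (proj₁ L) (unresize x∈ L) (unresize y∈ L)
      ; ⁻¹-closed = λ x∈ → resize λ L → Subgroup.⁻¹-closed (proj₁ L) (unresize x∈ L)
      }

    ∉core : ∀ {x} → x ∉ ⟦ core ⟧ → Σ[ (L , _) ∈ OpenSubgroup ] x ∉ ⟦ L ⟧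
    ∉core x∉ = dne λ none → x∉ (resize λ L → dne λ x∉L → none (L , x∉L))

    core-closed : Closed topology ⟦ core ⟧
    core-closed = open-local topology λ x∉ →
      let ((L , oL) , x∉L) = ∉core x∉
      in _ , open⇒closed L oL , x∉L , λ y∉L y∈ → y∉L (unresize y∈ (L , oL))

    abstract
      -- A Lebesgue number for a cover by two sets. Near each x a suitable `V` exists by continuity
      -- of multiplication at (x , ε). Shrinking `V` only enlarges `R V`, so the family is directed
      -- and compactness yields a single `V`.
      lebesgue : ∀ {C A B} → Compact topology C → Open topology A → Open topology B → C ⊆ A ∪ B →
        Σ[ (V , _) ∈ OpenNbhd-ε ] (∀ {x} → x ∈ C →
          (∀ {v} → v ∈ V → x ∙ v ∈ A) ⊎ (∀ {v} → v ∈ V → x ∙ v ∈ B))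
      lebesgue {C} {A} {B} C-compact oA oB C⊆A∪B = compact-directed topology C-compact
        R (_ , Topology.Open-all topology , _)
        (λ (V , oV , ε∈V) (W , oW , ε∈W) → (V ∩ W , Open-∩ oV oW , ε∈V , ε∈W) ,
          Sum.map (λ f (v , _) → f v) (λ f (v , _) → f v) ,
          Sum.map (λ f (_ , w) → f w) (λ f (_ , w) → f w))
        (λ x∈C → local (C⊆A∪B x∈C))
        where
        R : OpenNbhd-ε → Pred Carrier ℓ
        R (V , _) x = (∀ {v} → v ∈ V → x ∙ v ∈ A) ⊎ (∀ {v} → v ∈ V → x ∙ v ∈ B)
        near : ∀ {U x} → Open topology U → x ∈ U →
               ∃[ V ] ((Open topology V × ε ∈ V) × ∃[ O ] (Open topology O × x ∈ O ×
                 (∀ {y v} → y ∈ O → v ∈ V → y ∙ v ∈ U)))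
        near oU u =
          let (O , V , oO , oV , (x∈O , ε∈V) , s) =
                proj₂ (∙-cont _ oU) (Open-resp-≈ oU (sym (identityʳ _)) u)
          in V , (oV , ε∈V) , O , oO , x∈O , λ y v → s (y , v)
        local : ∀ {x} → x ∈ A ∪ B →
                ∃[ V ] ∃[ O ] (Open topology O × x ∈ O × O ⊆ R V)
        local (inj₁ a) = let (V , oV , O , oO , x∈O , s) = near oA a
                         in (V , oV) , O , oO , x∈O , λ y∈O → inj₁ (s y∈O)
        local (inj₂ b) = let (V , oV , O , oO , x∈O , s) = near oB b
                         in (V , oV) , O , oO , x∈O , λ y∈O → inj₂ (s y∈O)

    -- The stabilizer of `L ∩ A` under right translation by `L`. Asking for both implications gives
    -- closure under inverses: the condition for x at z x⁻¹ is the one for x⁻¹ at z, reversed.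
    stabilizer : (L : Subgroup group) (A : Pred Carrier ℓ) → A Respects _≈_ → Subgroup group
    stabilizer L A resp = record
      { ⟦_⟧       = λ x → x ∈ ⟦ L ⟧ ×
                      (∀ {z} → z ∈ ⟦ L ⟧ → (z ∈ A → z ∙ x ∈ A) × (z ∙ x ∈ A → z ∈ A))
      ; resp      = λ x≈y (x∈L , s) → L.resp x≈y x∈L , λ z∈L →
          resp (∙-congˡ x≈y) ∘ proj₁ (s z∈L) , proj₂ (s z∈L) ∘ resp (∙-congˡ (sym x≈y))
      ; ε-closed  = L.ε-closed , λ {z} _ → resp (sym (identityʳ z)) , resp (identityʳ z)
      ; ∙-closed  = λ {x} {y} (x∈L , s) (y∈L , t) → L.∙-closed x∈L y∈L , λ {z} z∈L →
          resp (assoc z x y) ∘ proj₁ (t (L.∙-closed z∈L x∈L)) ∘ proj₁ (s z∈L) ,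
          proj₂ (s z∈L) ∘ proj₂ (t (L.∙-closed z∈L x∈L)) ∘ resp (sym (assoc z x y))
      ; ⁻¹-closed = λ {x} (x∈L , s) → L.⁻¹-closed x∈L , λ {z} z∈L →
          let t = s (L.∙-closed z∈L (L.⁻¹-closed x∈L)) in
          proj₂ t ∘ resp (sym (//-rightDividesˡ x z)) ,
          resp (//-rightDividesˡ x z) ∘ proj₁ t
      }
      where module L = Subgroup L

    -- If A′ and B′ cover L and no step in W leads from A′ to B′, then L ∩ W
    -- stabilizes L ∩ A′, so the stabilizer is open.
    core⊆clopen : ∀ {A′ B′ : Pred Carrier ℓ} {x} ((L , _) : OpenSubgroup) →
      A′ Respects _≈_ → B′ Respects _≈_ →
      ⟦ L ⟧ ⊆ A′ ∪ B′ → ((W , _) : OpenNbhd-ε) → (∀ {v} → v ∈ W → v ⁻¹ ∈ W) →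
      (∀ {z v} → z ∈ A′ → z ∙ v ∈ B′ → v ∉ W) →
      ε ∈ A′ → x ∈ ⟦ core ⟧ → x ∈ A′
    core⊆clopen {A′} {B′} {x₀} (L , oL) resp-A′ resp-B′ L⊆A′∪B′
      (W , oW , ε∈W) W-⁻¹ separated ε∈A′ x₀∈core =
      -- The core lies in the open subgroup `M`, so right translation by `x₀` carries ε, a point of
      -- `A′`, into `A′`.
      resp-A′ (identityˡ x₀) (proj₁ (proj₂ x₀∈M L.ε-closed) ε∈A′)
      where
      module L = Subgroup L
      M = stabilizer L A′ resp-A′

      L∩W⊆M : ⟦ L ⟧ ∩ W ⊆ ⟦ M ⟧
      L∩W⊆M {x} (x∈L , x∈W) = x∈L , λ {z} z∈L →
        (λ z∈A′ → fromInj₁ (λ zx∈B′ → ⊥-elim (separated z∈A′ zx∈B′ x∈W))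
                    (L⊆A′∪B′ (L.∙-closed z∈L x∈L))) ,
        -- The step back from z x to z is by x⁻¹, which is in `W` by symmetry.
        (λ zx∈A′ → fromInj₁ (λ z∈B′ → ⊥-elim (separated zx∈A′
                      (resp-B′ (sym (//-rightDividesʳ x z)) z∈B′) (W-⁻¹ x∈W)))
                    (L⊆A′∪B′ z∈L))

      x₀∈M : x₀ ∈ ⟦ M ⟧
      x₀∈M = unresize x₀∈core (M , nbhd⇒open M
        (_ , Open-∩ oL oW , L.ε-closed , ε∈W) L∩W⊆M)

    -- The product set UW, a union of left translates of `W`; it is open for any `U` once `W` is.
    thicken : Pred Carrier ℓ → Pred Carrier ℓ → Pred Carrier ℓ
    thicken W U z = ∃[ a ] (a ∈ U × a ⁻¹ ∙ z ∈ W)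

    abstract
      open-thicken : ∀ {W} U → Open topology W → Open topology (thicken W U)
      open-thicken U oW = open-local topology λ (a , u , w) →
        _ , open-∙ˡ (a ⁻¹) oW , w , λ w′ → a , u , w′

      ⊆thicken : ∀ {U} ((W , _) : OpenNbhd-ε) → U ⊆ thicken W U
      ⊆thicken (W , oW , ε∈W) {x} u = x , u , Open-resp-≈ oW (sym (inverseˡ x)) ε∈W

    -- A step v in `W` from aw to bw′ would put b = a(w v w′⁻¹) in aV. If aV lies in `A`, then b is
    -- in both `A` and `B`; if it lies in `B`, then a is.
    thicken-separated : ∀ {C A B V W : Pred Carrier ℓ} → A Respects _≈_ → B Respects _≈_ →
      (∀ {x} → x ∈ C → (∀ {v} → v ∈ V → x ∙ v ∈ A) ⊎ (∀ {v} → v ∈ V → x ∙ v ∈ B)) →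
      ε ∈ V → (∀ {x} → x ∈ W → x ⁻¹ ∈ W) →
      (∀ {x y z} → x ∈ W → y ∈ W → z ∈ W → x ∙ y ∙ z ∈ V) →
      (∀ {x} → x ∈ C → x ∈ A → x ∉ B) →
      ∀ {z v} → z ∈ thicken W (C ∩ A) → z ∙ v ∈ thicken W (C ∩ B) → v ∉ W
    thicken-separated {C} {A} {B} {V} {W} resp-A resp-B lebesgue-V ε∈V W-⁻¹ WWW⊆V disjoint
      {z} {v} (a , (a∈C , a∈A) , p) (b , (b∈C , b∈B) , q) r =
      [ (λ aV⊆A → disjoint b∈C (resp-A ac≈b (aV⊆A (WWW⊆V p r (W-⁻¹ q)))) b∈B)
      , (λ aV⊆B → disjoint a∈C a∈A (resp-B (identityʳ a) (aV⊆B ε∈V)))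
      ] (lebesgue-V a∈C)
      where
      ac≈b : a ∙ ((a ⁻¹ ∙ z) ∙ v ∙ (b ⁻¹ ∙ (z ∙ v)) ⁻¹) ≈ b
      ac≈b = begin
        a ∙ ((a ⁻¹ ∙ z) ∙ v ∙ (b ⁻¹ ∙ (z ∙ v)) ⁻¹)
          ≈⟨ ∙-congˡ (∙-cong (assoc _ _ _) (⁻¹-anti-homo-\\ b (z ∙ v))) ⟩
        a ∙ (a ⁻¹ ∙ (z ∙ v) ∙ ((z ∙ v) ⁻¹ ∙ b))
          ≈⟨ assoc _ _ _ ⟨
        a ∙ (a ⁻¹ ∙ (z ∙ v)) ∙ ((z ∙ v) ⁻¹ ∙ b)
          ≈⟨ ∙-congʳ (\\-leftDividesˡ a (z ∙ v)) ⟩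
        z ∙ v ∙ ((z ∙ v) ⁻¹ ∙ b)
          ≈⟨ \\-leftDividesˡ (z ∙ v) b ⟩
        b ∎

    module _ (compact : CompactSpace topology) where

      -- The compact set `∁ U` is covered by the complements of open subgroups. These are directed,
      -- since `⊓` intersects the subgroups, so a single complement contains `∁ U`.
      core⊆open⇒subgroup⊆open : ∀ {U} → Open topology U → ⟦ core ⟧ ⊆ U →
                                Σ[ (L , _) ∈ OpenSubgroup ] ⟦ L ⟧ ⊆ U
      core⊆open⇒subgroup⊆open {U} oU core⊆U =
        let (L , ∁U⊆∁L) = compact-directed topology ∁U-compact
              (λ (L , _) → ∁ ⟦ L ⟧) whole
              (λ (H , oH) (L , oL) → (H ⊓ L , Open-∩ oH oL) , (λ x∉H → x∉H ∘ proj₁) ,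
                 (λ x∉L → x∉L ∘ proj₂))
              (λ x∉U → let ((L , oL) , x∉L) = ∉core (x∉U ∘ core⊆U)
                       in (L , oL) , _ , open⇒closed L oL , x∉L , id)
        in L , λ x∈L → dne λ x∉U → ∁U⊆∁L x∉U x∈L
        where
        ∁U-compact : Compact topology (∁ U)
        ∁U-compact = closed⊆compact⇒compact topology compact
          (Open-resp-≐ ((λ u x∉U → x∉U u) , dne) oU) _
        whole : OpenSubgroup
        whole = record
          { ⟦_⟧       = λ _ → ⊤
          ; resp      = _
          ; ε-closed  = tt
          ; ∙-closed  = _
          ; ⁻¹-closed = _
          } , Topology.Open-resp-≐ topology (_ , _) (Topology.Open-all topology)

      core-compact : Compact topology ⟦ core ⟧
      core-compact = closed⊆compact⇒compact topology compact core-closed _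

      -- The parts of the core in A and in B are compact and disjoint, so they have
      -- thickenings separated by a neighbourhood W of ε; these cover an open
      -- subgroup of the compact group.
      core∩B-empty : ∀ {A B} → Open topology A → Open topology B → ⟦ core ⟧ ⊆ A ∪ B →
                     (∀ {x} → x ∈ ⟦ core ⟧ → x ∈ A → x ∉ B) →
                     ε ∈ A → ∀ {x} → x ∈ ⟦ core ⟧ → x ∉ B
      core∩B-empty {A} {B} oA oB core⊆A∪B disjoint ε∈A x∈core x∈B
        with (V , oV , ε∈V) , lebesgue-V ← lebesgue core-compact oA oB core⊆A∪B
        with W@(_ , oW , ε∈W) , W-⁻¹ , WWW⊆V ← symmetricCubeRoot (V , oV , ε∈V)
        with L , L⊆A′∪B′ ← core⊆open⇒subgroup⊆open
               (open-∪ topology (open-thicken (⟦ core ⟧ ∩ A) oW) (open-thicken (⟦ core ⟧ ∩ B) oW))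
               (λ y∈core → Sum.map (λ a → ⊆thicken W (y∈core , a))
                 (λ b → ⊆thicken W (y∈core , b)) (core⊆A∪B y∈core))
        -- `core⊆clopen` places x in the thickening of the `A` part, yet x = x ε is in that of the
        -- `B` part: a forbidden step by ε.
        = separated x∈A′ (resp-B′ (sym (identityʳ _)) (⊆thicken W (x∈core , x∈B))) ε∈W
        where
        resp-B′ = Open-resp-≈ (open-thicken (⟦ core ⟧ ∩ B) oW)
        separated : ∀ {z v} → z ∈ thicken (proj₁ W) (⟦ core ⟧ ∩ A) →
                    z ∙ v ∈ thicken (proj₁ W) (⟦ core ⟧ ∩ B) → v ∉ proj₁ W
        separated = thicken-separated (Open-resp-≈ oA) (Open-resp-≈ oB)
          lebesgue-V ε∈V W-⁻¹ WWW⊆V disjoint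
        x∈A′ = core⊆clopen L (Open-resp-≈ (open-thicken (⟦ core ⟧ ∩ A) oW)) resp-B′ L⊆A′∪B′
          W W-⁻¹ separated (⊆thicken W (Subgroup.ε-closed core , ε∈A)) x∈core

      core-connected : Connected topology ⟦ core ⟧
      core-connected A B oA oB core⊆A∪B (a , a∈N , a∈A) (b , b∈N , b∈B) = dne λ none →
        [ (λ ε∈A → core∩B-empty oA oB core⊆A∪B
                     (λ x∈N x∈A x∈B → none (_ , x∈N , x∈A , x∈B)) ε∈A b∈N b∈B)
        , (λ ε∈B → core∩B-empty oB oA (Sum.swap ∘ core⊆A∪B)
                     (λ x∈N x∈B x∈A → none (_ , x∈N , x∈A , x∈B)) ε∈B a∈N a∈A)
        ] (core⊆A∪B (Subgroup.ε-closed core))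

      module _ (disconnected : TotallyDisconnected topology) where

        core-trivial : ∀ {x} → x ∈ ⟦ core ⟧ → x ≈ ε
        core-trivial x∈ = disconnected ⟦ core ⟧ (Subgroup.resp core) core-connected
          x∈ (Subgroup.ε-closed core)

        vanDantzig : ((U , _) : OpenNbhd-ε) → Σ[ (L , _) ∈ OpenSubgroup ] ⟦ L ⟧ ⊆ U
        vanDantzig (U , oU , ε∈U) = core⊆open⇒subgroup⊆open oU
          λ x∈ → Open-resp-≈ oU (sym (core-trivial x∈)) ε∈U

    -- Conjugate subgroups and a criterion for discreteness.

    conj-cancelˡ : ∀ g x → g ⁻¹ ∙ (g ∙ x ∙ g ⁻¹) ∙ g ⁻¹ ⁻¹ ≈ x
    conj-cancelˡ g x = begin
      g ⁻¹ ∙ (g ∙ x ∙ g ⁻¹) ∙ g ⁻¹ ⁻¹    ≈⟨ ∙-congʳ (∙-congˡ (assoc g x (g ⁻¹))) ⟩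
      g ⁻¹ ∙ (g ∙ (x ∙ g ⁻¹)) ∙ g ⁻¹ ⁻¹  ≈⟨ ∙-congʳ (\\-leftDividesʳ g (x ∙ g ⁻¹)) ⟩
      x ∙ g ⁻¹ ∙ g ⁻¹ ⁻¹                 ≈⟨ //-rightDividesʳ (g ⁻¹) x ⟩
      x                                  ∎

    conj-cancelʳ : ∀ g x → g ∙ (g ⁻¹ ∙ x ∙ g ⁻¹ ⁻¹) ∙ g ⁻¹ ≈ x
    conj-cancelʳ g x = begin
      g ∙ (g ⁻¹ ∙ x ∙ g ⁻¹ ⁻¹) ∙ g ⁻¹    ≈⟨ ∙-congʳ (∙-congˡ (assoc (g ⁻¹) x (g ⁻¹ ⁻¹))) ⟩
      g ∙ (g ⁻¹ ∙ (x ∙ g ⁻¹ ⁻¹)) ∙ g ⁻¹  ≈⟨ ∙-congʳ (\\-leftDividesˡ g (x ∙ g ⁻¹ ⁻¹)) ⟩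
      x ∙ g ⁻¹ ⁻¹ ∙ g ⁻¹                 ≈⟨ //-rightDividesˡ (g ⁻¹) x ⟩
      x                                  ∎

    conj-swapˡ : ∀ {g x y} → x ≈ g ∙ y ∙ g ⁻¹ → y ≈ g ⁻¹ ∙ x ∙ g ⁻¹ ⁻¹
    conj-swapˡ {g} {x} {y} x≈ = sym (trans (∙-congʳ (∙-congˡ x≈)) (conj-cancelˡ g y))

    conj-swapʳ : ∀ {g x y} → x ≈ g ⁻¹ ∙ y ∙ g ⁻¹ ⁻¹ → y ≈ g ∙ x ∙ g ⁻¹
    conj-swapʳ {g} {x} {y} x≈ = sym (trans (∙-congʳ (∙-congˡ x≈)) (conj-cancelʳ g y))

    conjugateSubgroup : Carrier → Subgroup group → Subgroup group
    conjugateSubgroup g L = record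
      { ⟦_⟧       = conjugate G g ⟦ L ⟧
      ; resp      = λ x≈y (s , s∈L , x≈) → s , s∈L , trans (sym x≈y) x≈
      ; ε-closed  = ε , L.ε-closed , sym (trans (∙-congʳ (identityʳ g)) (inverseʳ g))
      ; ∙-closed  = λ {x} {y} (s , s∈L , x≈) (t , t∈L , y≈) → s ∙ t , L.∙-closed s∈L t∈L , (begin
          x ∙ y                              ≈⟨ ∙-cong x≈ y≈ ⟩
          g ∙ s ∙ g ⁻¹ ∙ (g ∙ t ∙ g ⁻¹)      ≈⟨ assoc _ _ _ ⟨
          g ∙ s ∙ g ⁻¹ ∙ (g ∙ t) ∙ g ⁻¹      ≈⟨ ∙-congʳ (assoc _ _ _) ⟩
          g ∙ s ∙ (g ⁻¹ ∙ (g ∙ t)) ∙ g ⁻¹    ≈⟨ ∙-congʳ (∙-congˡ (\\-leftDividesʳ g t)) ⟩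
          g ∙ s ∙ t ∙ g ⁻¹                   ≈⟨ ∙-congʳ (assoc g s t) ⟩
          g ∙ (s ∙ t) ∙ g ⁻¹                 ∎)
      ; ⁻¹-closed = λ {x} (s , s∈L , x≈) → s ⁻¹ , L.⁻¹-closed s∈L , (begin
          x ⁻¹                               ≈⟨ ⁻¹-cong x≈ ⟩
          (g ∙ s // g) ⁻¹                    ≈⟨ ⁻¹-anti-homo-// (g ∙ s) g ⟩
          g ∙ (g ∙ s) ⁻¹                     ≈⟨ ∙-congˡ (⁻¹-anti-homo-∙ g s) ⟩
          g ∙ (s ⁻¹ ∙ g ⁻¹)                  ≈⟨ assoc g (s ⁻¹) (g ⁻¹) ⟨
          g ∙ s ⁻¹ ∙ g ⁻¹                    ∎)
      }
      where module L = Subgroup L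

    conjugate-open : ∀ g (L : Subgroup group) → Open topology ⟦ L ⟧ →
                     Open topology ⟦ conjugateSubgroup g L ⟧
    conjugate-open g L oL = Open-resp-≐
      ((λ {x} x∈ → _ , x∈ , sym (conj-cancelʳ g x)) ,
       (λ (_ , s∈L , x≈) → Subgroup.resp L (conj-swapˡ x≈) s∈L))
      (open-∙ˡ (g ⁻¹) (open-∙ʳ (g ⁻¹ ⁻¹) oL))

    -- Each s in `D` is the only point of `D` in the open coset sH. Hence any `S` is the trace on
    -- `D` of the union of the cosets sH with s in `S`.
    trivialIntersection⇒discrete : (D H : Subgroup group) → Open topology ⟦ H ⟧ →
      (∀ {x} → x ∈ ⟦ D ⟧ → x ∈ ⟦ H ⟧ → x ≈ ε) →
      Discrete (TopologicalGroup.topology (topologicalSubgroup G D))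
    trivialIntersection⇒discrete D H oH trivial S resp =
      V , open-V , (λ {x} x∈S → x , x∈S , H.resp (sym (inverseˡ (proj₁ x))) H.ε-closed) ,
      λ {x} ((s , s∈D) , s∈S , s⁻¹x∈H) → resp
        (sym (trans (inverseʳ-unique _ _ (trivial (D.∙-closed (D.⁻¹-closed s∈D) (proj₂ x)) s⁻¹x∈H))
                    (⁻¹-involutive s)))
        s∈S
      where
      module D = Subgroup D
      module H = Subgroup H
      V : Pred Carrier ℓ
      V x = Σ[ (s , s∈D) ∈ ∃ ⟦ D ⟧ ] ((s , s∈D) ∈ S × s ⁻¹ ∙ x ∈ ⟦ H ⟧)
      open-V : Open topology V
      open-V = open-local topology λ ((s , s∈D) , s∈S , x∈) →
        _ , open-∙ˡ (s ⁻¹) oH , x∈ , λ y∈ → (s , s∈D) , s∈S , y∈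

    -- Limits in the Chabauty space.

    -- Ultrafilters of closed subgroups converge, i.e. the Chabauty space is
    -- compact.
    module UltrafilterLimit {I : Set ℓ} (S : I → ClosedSubgroup G)
      (𝓤 : Pred (Pred I ℓ) (lsuc ℓ)) (𝓤-ultra : IsUltrafilter 𝓤) where
      open IsFilter (proj₁ 𝓤-ultra)

      Hitting : Pred Carrier ℓ → Pred I ℓ
      Hitting O i = ⟦ proj₁ (S i) ⟧ ≬ O

      -- The Kuratowski limit of the sets `S i` along `𝓤`; it is resized because it quantifies over
      -- all open sets.
      Limit : Pred Carrier ℓ
      Limit x = Resize ℓ (∀ O → Open topology O → x ∈ O → Hitting O ∈ 𝓤)

      ∉Limit : ∀ {x} → x ∉ Limit → ∃[ O ] (Open topology O × x ∈ O × Hitting O ∉ 𝓤)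
      ∉Limit x∉ = dne λ none → x∉ (resize λ O oO x∈O → dne λ O∉ → none (O , oO , x∈O , O∉))

      limitSubgroup : Subgroup group
      limitSubgroup = record
        { ⟦_⟧       = Limit
        ; resp      = λ x≈y x∈ → resize λ O oO y∈O →
            unresize x∈ O oO (Open-resp-≈ oO (sym x≈y) y∈O)
        ; ε-closed  = resize λ O oO ε∈O →
            upward (λ {i} _ → ε , Subgroup.ε-closed (proj₁ (S i)) , ε∈O) whole
        ; ∙-closed  = λ x∈ y∈ → resize λ O oO xy∈O →
            let (A , B , oA , oB , (x∈A , y∈B) , AB⊆O) = proj₂ (∙-cont O oO) xy∈O in
            upward (λ {i} ((a , a∈S , a∈A) , (b , b∈S , b∈B)) →
                      a ∙ b , Subgroup.∙-closed (proj₁ (S i)) a∈S b∈S , AB⊆O (a∈A , b∈B))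
                   (∩-closed (unresize x∈ A oA x∈A) (unresize y∈ B oB y∈B))
        ; ⁻¹-closed = λ x∈ → resize λ O oO x⁻¹∈O →
            upward (λ {i} (a , a∈S , a⁻¹∈O) → a ⁻¹ , Subgroup.⁻¹-closed (proj₁ (S i)) a∈S , a⁻¹∈O)
                   (unresize x∈ (λ y → y ⁻¹ ∈ O) (⁻¹-cont O oO) x⁻¹∈O)
        }

      limit : ClosedSubgroup G
      limit = limitSubgroup , open-local topology λ x∉ →
        let (O , oO , x∈O , O∉𝓤) = ∉Limit x∉
        in O , oO , x∈O , λ y∈O y∈ → O∉𝓤 (unresize y∈ O oO y∈O)

      converges : ∀ {𝓞} → Open (chabauty G) 𝓞 → limit ∈ 𝓞 →
                  ∃[ A ] (A ∈ 𝓤 × (∀ {i} → i ∈ A → S i ∈ 𝓞))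
      converges (basic (miss {Q} _ Q-compact)) (lift disjoint) =
        -- A point of `Q` is no limit point, so it has a neighbourhood that `𝓤`-almost every `S i`
        -- avoids. Compactness makes one member of `𝓤` serve all of `Q`.
        let ((A , A∈𝓤) , Q⊆R) = compact-directed topology Q-compact
              R (_ , whole)
              (λ (A , A∈𝓤) (B , B∈𝓤) → (A ∩ B , ∩-closed A∈𝓤 B∈𝓤) ,
                (λ r (i∈A , _) → r i∈A) , (λ r (_ , i∈B) → r i∈B))
              (λ x∈Q → let (O , oO , x∈O , O∉𝓤) = ∉Limit (λ x∈ → disjoint _ (x∈ , x∈Q))
                       in (∁ (Hitting O) , proj₂ 𝓤-ultra _ O∉𝓤) , O , oO , x∈O ,
                          λ y∈O i∉ y∈S → i∉ (_ , y∈S , y∈O))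
        in A , A∈𝓤 , λ i∈A → lift λ x (x∈S , x∈Q) → Q⊆R x∈Q i∈A x∈S
        where
        R : ∃ 𝓤 → Pred Carrier ℓ
        R (A , _) y = ∀ {i} → i ∈ A → y ∉ ⟦ proj₁ (S i) ⟧
      converges (basic (hit {O} oO)) (lift (x , x∈ , x∈O)) =
        Hitting O , unresize x∈ O oO x∈O , lift
      converges (resp-≐ (𝓞⊆ , ⊆𝓞) o) ∈𝓞 =
        let (A , A∈𝓤 , s) = converges o (⊆𝓞 ∈𝓞) in A , A∈𝓤 , 𝓞⊆ ∘ s
      converges all _ = _ , whole , λ _ → lift _
      converges (inter o o′) (∈𝓞 , ∈𝓞′) =
        let (A , A∈𝓤 , s)   = converges o ∈𝓞
            (A′ , A′∈𝓤 , s′) = converges o′ ∈𝓞′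
        in A ∩ A′ , ∩-closed A∈𝓤 A′∈𝓤 , λ (i∈A , i∈A′) → s i∈A , s′ i∈A′
      converges (union o) (j , ∈𝓞) =
        let (A , A∈𝓤 , s) = converges (o j) ∈𝓞 in A , A∈𝓤 , λ i∈A → j , s i∈A

  -- Small open subgroups of G inside K.

  module ProfiniteOpenSubgroup {ℓ} (G : TopologicalGroup ℓ)
    (K : Subgroup (TopologicalGroup.group G))
    (oK : Open (TopologicalGroup.topology G) ⟦ K ⟧)
    (K-profinite : Profinite (topologicalSubgroup G K)) where
    open TopologicalGroup G
    open Topology topology using (Open-∩; Open-resp-≐)
    open GroupTopology G
    private
      module K = Subgroup K
      module KT = GroupTopology (topologicalSubgroup G K)
      compact = proj₁ K-profinite
      disconnected = proj₂ (proj₂ K-profinite)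

    inclusion : Subgroup (subgroup K) → Subgroup group
    inclusion L = record
      { ⟦_⟧       = λ x → Σ[ k ∈ x ∈ ⟦ K ⟧ ] (x , k) ∈ ⟦ L ⟧
      ; resp      = λ x≈y (k , l) → K.resp x≈y k , L.resp x≈y l
      ; ε-closed  = K.ε-closed , L.ε-closed
      ; ∙-closed  = λ (k , l) (k′ , l′) → K.∙-closed k k′ , L.∙-closed l l′
      ; ⁻¹-closed = λ (k , l) → K.⁻¹-closed k , L.⁻¹-closed l
      }
      where module L = Subgroup L

    inclusion-open : KT.OpenSubgroup → OpenSubgroup
    inclusion-open (L , V , oV , L⊆V , V⊆L) = inclusion L , Open-resp-≐
      ((λ (k , v) → k , V⊆L v) , (λ (k , l) → k , L⊆V l)) (Open-∩ oK oV)

    smallOpenSubgroup : ((U , _) : OpenNbhd-ε) →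
                        Σ[ (L , _) ∈ OpenSubgroup ] (⟦ L ⟧ ⊆ ⟦ K ⟧ × ⟦ L ⟧ ⊆ U)
    smallOpenSubgroup (U , oU , ε∈U) =
      let (L , L⊆U) = KT.vanDantzig compact disconnected
                        (U ∘ proj₁ , (U , oU , id , id) , ε∈U)
      in inclusion-open L , proj₁ , λ (k , l) → L⊆U l

    openSubgroups-separate : ∀ {x} → ((L : OpenSubgroup) → x ∈ ⟦ proj₁ L ⟧) → x ≈ ε
    openSubgroups-separate {x} x∈ = KT.core-trivial compact disconnected {x , x∈ (K , oK)}
      -- `resp` at `refl` replaces one proof that x is in `K` by another.
      (resize λ L → Subgroup.resp (proj₁ L) refl (proj₂ (x∈ (inclusion-open L))))

    -- The difference is closed, with complement `∁ H ∪ L`, and lies in the compact `K`.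
    difference-compact : ((H , _) (L , _) : OpenSubgroup) → ⟦ H ⟧ ⊆ ⟦ K ⟧ →
                         Compact topology (⟦ H ⟧ ∩ ∁ ⟦ L ⟧)
    difference-compact (H , oH) (L , oL) H⊆K = closed⊆compact⇒compact topology
      (compactSubspace⇒compact topology compact)
      (Open-resp-≐
        ((λ { (inj₁ x∉H) (x∈H , _) → x∉H x∈H ; (inj₂ x∈L) (_ , x∉L) → x∉L x∈L }) ,
         (λ {x} x∉ → case em {P = x ∈ ⟦ L ⟧} of λ where
            (yes x∈L) → inj₂ x∈L
            (no x∉L)  → inj₁ λ x∈H → x∉ (x∈H , x∉L)))
        (open-∪ topology (open⇒closed H oH) oL))
      (H⊆K ∘ proj₁)

    -- Fairness and the closure of the conjugates.

    fair⇒nonDiscrete : Fair G K → closure (chabauty G) (conjugatesOf G K) ⊆ nonDiscreteSubgroups G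
    fair⇒nonDiscrete fair {D , _} ∈closure discrete
      -- Discreteness makes the identity open in `D`: `V` meets `D` only there.
      with V , oV , ε⊆V , V⊆ε ← discrete (λ x → proj₁ x ≈ ε) (λ x≈y x≈ε → trans (sym x≈y) x≈ε)
      with (H , oH) , H⊆K , H⊆V ← smallOpenSubgroup (V , oV , ε⊆V {ε , Subgroup.ε-closed D} refl)
      with H′ , oH′ , _ , strict ← fair H oH H⊆K
      with _ , (g , _ , gKg⁻¹⊆E) , lift E-misses ← ∈closure _
        (basic (miss
          (λ x≈y (x∈H , x∉H′) → Subgroup.resp H x≈y x∈H , x∉H′ ∘ Subgroup.resp H′ (sym x≈y))
          (difference-compact (H , oH) (H′ , oH′) H⊆K)))
        (lift λ x (x∈D , x∈H , x∉H′) → x∉H′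
          (Subgroup.resp H′ (sym (V⊆ε {x , x∈D} (H⊆V x∈H))) (Subgroup.ε-closed H′)))
      -- Since gKg⁻¹ misses H minus H′, conjugating back makes the inclusion at g⁻¹ an equality.
      = proj₂ (strict (g ⁻¹)) λ (x∈K , h , h∈H , x≈) → x∈K , h ,
          dne (λ h∉H′ → E-misses h (gKg⁻¹⊆E (_ , x∈K , conj-swapʳ x≈) , h∈H , h∉H′)) , x≈

    module _ (H : Subgroup group) (oH : Open topology ⟦ H ⟧)
      (H⊆K : ⟦ H ⟧ ⊆ ⟦ K ⟧) where

      FairFor : Subgroup group → Set (lsuc ℓ)
      FairFor H′ = Open topology ⟦ H′ ⟧ × ⟦ H′ ⟧ ⊆ ⟦ K ⟧ ×
        (∀ g → (⟦ K ⟧ ∩ conjugate G g ⟦ H′ ⟧) ⊂ (⟦ K ⟧ ∩ conjugate G g ⟦ H ⟧))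

      Within : Subgroup group → Pred Carrier ℓ
      Within L g = conjugate G g ⟦ K ⟧ ∩ ⟦ H ⟧ ⊆ ⟦ L ⟧

      module _ (unfair : ¬ ∃ FairFor) where

        -- `H ⊓ L` is tried as `H′`. Strictness must fail at some g, and conjugating the reverse
        -- inclusion by g⁻¹ shows that g⁻¹ is in `Within L`.
        within-nonempty : ((L , _) : OpenSubgroup) → Satisfiable (Within L)
        within-nonempty (L , oL) = dne λ none → unfair (H ⊓ L , Open-∩ oH oL , H⊆K ∘ proj₁ ,
          λ g → (λ (x∈K , h , (h∈H , _) , x≈) → x∈K , h , h∈H , x≈) ,
          λ ⊇ → none (g ⁻¹ , λ {_} ((k , k∈K , y≈) , y∈H) →
            let (_ , h , (_ , h∈L) , k≈) = ⊇ (k∈K , _ , y∈H , conj-swapʳ y≈)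
            in Subgroup.resp L (trans (conj-swapˡ k≈) (sym y≈)) h∈L))

        WithinFilter : Pred (Pred Carrier ℓ) (lsuc ℓ)
        WithinFilter A = Σ[ (L , _) ∈ OpenSubgroup ] Within L ⊆ A

        withinFilter-isFilter : IsFilter WithinFilter
        withinFilter-isFilter = record
          { upward   = λ A⊆B (L , s) → L , λ {_} w → A⊆B (s w)
          ; ∩-closed = λ ((L , oL) , s) ((L′ , oL′) , s′) → (L ⊓ L′ , Open-∩ oL oL′) ,
              λ w → s (λ x∈ → proj₁ (w x∈)) , s′ (λ x∈ → proj₂ (w x∈))
          ; whole    = (K , oK) , _
          ; nonempty = λ (L , s) → let (g , w) = within-nonempty L in g , s w
          }

        conjugateOf : Carrier → ClosedSubgroup G
        conjugateOf g = conjugateSubgroup g K ,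
          open⇒closed (conjugateSubgroup g K) (conjugate-open g K oK)

        limitPoint : ∃[ D ] (D ∈ closure (chabauty G) (conjugatesOf G K) × D ∉ nonDiscreteSubgroups G)
        limitPoint
          with 𝓤 , 𝓤-ultra , ⊆𝓤 ← ultrafilter WithinFilter withinFilter-isFilter
          = limit ,
            (λ 𝓞 o limit∈𝓞 →
              let (A , A∈𝓤 , A⊆) = converges o limit∈𝓞
                  (g , g∈A)      = nonempty A∈𝓤
              in conjugateOf g , (g , id , id) , A⊆ g∈A) ,
            λ nonDiscrete → nonDiscrete (trivialIntersection⇒discrete limitSubgroup H oH
              -- If x were outside `L`, then H minus L would be a neighbourhood of x, hit by
              -- `𝓤`-almost all conjugates. `Within L` is in `𝓤` as well, and any g common to both
              -- is contradictory.
              λ x∈ x∈H → openSubgroups-separate λ (L , oL) → dne λ x∉L →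
                let (g , (y , y∈gKg⁻¹ , y∈H , y∉L) , within) = nonempty (∩-closed
                      (unresize x∈ _ (Open-∩ oH (open⇒closed L oL)) (x∈H , x∉L))
                      (⊆𝓤 {Within L} ((L , oL) , λ w {_} → w)))
                in y∉L (within (y∈gKg⁻¹ , y∈H)))
          where
          open UltrafilterLimit conjugateOf 𝓤 𝓤-ultra
          open IsFilter (proj₁ 𝓤-ultra)

    nonDiscrete⇒fair : closure (chabauty G) (conjugatesOf G K) ⊆ nonDiscreteSubgroups G → Fair G K
    nonDiscrete⇒fair nonDiscrete H oH H⊆K = dne λ unfair →
      let (_ , D∈closure , D∉) = limitPoint H oH H⊆K unfair in D∉ (nonDiscrete D∈closure)

proposition7p1 : (∀ {a} → ExcludedMiddle a) →
    (∀ {a b} → Extensionality a b) →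
    ∀ {ℓ} (G : TopologicalGroup ℓ) →
    LocallyProfinite G →
    ¬ Discrete (TopologicalGroup.topology G) →
    (K : Subgroup (TopologicalGroup.group G)) →
    Open (TopologicalGroup.topology G) ⟦ K ⟧ →
    Profinite (topologicalSubgroup G K) →
    Fair G K ⇔ (closure (chabauty G) (conjugatesOf G K) ⊆ nonDiscreteSubgroups G)
proposition7p1 em ext G _ _ K oK K-profinite = mk⇔ fair⇒nonDiscrete nonDiscrete⇒fair
  where open Classical.ProfiniteOpenSubgroup em ext G K oK K-profinite
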